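{- For all $n,s,h \in \mathbb{Z}^+$ with $1 \leq s \leq n-2$, $\gcd(s,n)=1$, and $0 \leq h \leq n-1$, there is an $s$-overlap cycle for $\mathcal{W}(n,h)$.
   Context: $\mathcal{W}(n)$ denotes the set of weak orders on $[n]$ (transitive and complete relations), represented as words: $\mathcal{W}(n)$ is the set of all words $w_1w_2\ldots w_n$ of length $n$ over the nonnegative integers such that $\{w_1,\dots,w_n\} = \{0,1,\dots,h\}$ for some $h$ with $0 \le h \le n-1$ (here $w_j$ is the height of element $j$ in the weak order). This $h$, i.e. the maximum letter of $w$, is the height of $w$, and $\mathcal{W}(n,h)$ is the set of $w \in \mathcal{W}(n)$ of height $h$; that is, the set of words $w_1\ldots w_n$ with $\{w_1,\dots,w_n\}=\{0,1,\dots,h\}$. An $s$-overlap cycle ($s$-ocycle) for a set of words of length $n$ is a cyclically ordered listing of the words in the set, each appearing exactly once, such that the last $s$ letters of each word are the first $s$ letters (in the same order) of its successor in the listing (the successor of the last word being the first word). -}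

module Defs where

open import Data.List.Base using (List; []; _∷_; _∷ʳ_; take; drop)
open import Data.List.Membership.Propositional using (_∈_)
open import Data.List.Relation.Unary.Linked using (Linked)
open import Data.List.Relation.Unary.Unique.Propositional using (Unique)
open import Data.Nat.Base using (ℕ; _∸_; _≤_)
open import Data.Unit.Base using (⊤)
open import Data.Vec.Base using (Vec; toList)
import Data.Vec.Membership.Propositional as Vec
open import Function.Bundles using (_⇔_)
open import Level using (0ℓ)
open import Relation.Binary.Core using (Rel)
open import Relation.Binary.PropositionalEquality.Core using (_≡_)
open import Relation.Unary using (Pred)

Word : ℕ → Set
Word n = Vec ℕ n

-- Weak orders on [n] of height h: the words whose set of letters is
-- exactly {0, 1, …, h}.
𝒲 : (n h : ℕ) → Pred (Word n) 0ℓ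
𝒲 n h w = ∀ k → (k Vec.∈ w) ⇔ (k ≤ h)

-- Meaningful for s ≤ n, so that n ∸ s is a true difference and drop
-- leaves exactly the last s letters.
Overlap : ∀ {n} (s : ℕ) → Rel (Word n) 0ℓ
Overlap {n} s u v = drop (n ∸ s) (toList u) ≡ take s (toList v)

-- Repeating the first entry at the end makes Linked also relate the last
-- entry to the first one; a one-entry list is thus related to itself.
CyclicallyLinked : ∀ {A : Set} → Rel A 0ℓ → List A → Set
CyclicallyLinked R []       = ⊤
CyclicallyLinked R (x ∷ xs) = Linked R (x ∷ (xs ∷ʳ x))

record IsOcycle {n} (s : ℕ) (P : Pred (Word n) 0ℓ) (ws : List (Word n)) : Set where
  field
    unique   : Unique ws
    lists    : ∀ w → (w ∈ ws) ⇔ P w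
    overlaps : CyclicallyLinked (Overlap s) ws

{-# OPTIONS --safe #-}

-- Regard every word as an edge from its first s letters to its last s letters;
-- an s-overlap cycle is then an Eulerian circuit.  Moving the first n - s letters
-- of a word to its end sends each edge to a consecutive one, so the edges fall
-- into closed orbits, and two orbits containing words with equal first s letters
-- can be spliced.  Since gcd (s , n) = 1, all rotations of a word lie in its orbit,
-- and since n - s ≥ 2, splicing also joins words differing in two adjacent letters.
-- Hence letters can be permuted at will, and after permuting any word to the form
-- r 0 1 … h, the letters of r can be replaced one at a time.
module Submission where

open import Defs
open import Data.List.Base
  using (List; []; _∷_; _∷ʳ_; _++_; [_]; applyUpTo; cartesianProductWith; drop; filter; length; map; take)
open import Data.List.Membership.Propositional using (_∈_; _∉_)
open import Data.List.Membership.Propositional.Properties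
  using (∈-++⁺ˡ; ∈-++⁺ʳ; ∈-++⁻; ∈-applyUpTo⁺; ∈-applyUpTo⁻; ∈-cartesianProductWith⁺;
         ∈-filter⁺; ∈-filter⁻; ∈-map⁺; ∈-map⁻; ∈-upTo⁺; ∈-upTo⁻; ∈-∃++)
open import Data.List.Properties
  using (++-assoc; ++-identityʳ; ∷ʳ-++; ∷ʳ-injective; applyUpTo-∷ʳ; length-++; length-drop;
         length-take; map-++; take++drop≡id; take-all; ≡-dec)
open import Data.List.Relation.Binary.Permutation.Propositional
  using (_↭_; prep; swap; ↭-refl; ↭-prep; ↭-reflexive; ↭-swap; ↭-sym; ↭-trans; ↭⇒↭ₛ)
open import Data.List.Relation.Binary.Permutation.Propositional.Properties
  using (∈-resp-↭; ++-comm; ++⁺ˡ; shift; shifts; ↭-length; ∷↭∷ʳ)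
import Data.List.Relation.Binary.Permutation.Setoid.Properties as PermutationSetoid
open import Data.List.Relation.Binary.Subset.Propositional using (_⊆_)
import Data.List.Relation.Unary.All as All
import Data.List.Relation.Unary.AllPairs as AllPairs
open import Data.List.Relation.Unary.Any as Any using (here; there)
open import Data.List.Relation.Unary.Linked as Linked using (Linked; []; [-]; _∷_)
import Data.List.Relation.Unary.Linked.Properties as Linkedₚ
open import Data.List.Relation.Unary.Unique.Propositional using (Unique)
import Data.List.Relation.Unary.Unique.Propositional.Properties as Unique
open import Data.Nat.Base
  using (ℕ; zero; suc; _+_; _*_; _∸_; _≤_; _<_; s≤s)
open import Data.Nat.Coprimality using (Coprime; coprime-Bézout; gcd≡1⇒coprime)
open import Data.Nat.Divisibility using (∣m+n∣m⇒∣n)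
open import Data.Nat.GCD using (gcd; module Bézout)
open import Data.Nat.GeneralisedArithmetic using (fold; fold-+)
open import Data.Nat.Induction using (<-rec)
open import Data.Nat.Properties
  using (+-assoc; +-cancelʳ-≡; +-comm; +-suc; *-comm; <-≤-trans; <⇒≤; ≤-pred; ≤-reflexive;
         anyUpTo?; m+n∸m≡n; m+n∸n≡m; m∸n+n≡m; m≤m+n; m≤n+m; m≤n⇒m<n∨m≡n; m≤n⇒m⊓n≡m;
         m≤n⇒∃[o]m+o≡n; suc-injective)
  renaming (_≟_ to _≟ℕ_)
open import Data.Nat.Tactic.RingSolver using (solve-∀)
open import Data.Product.Base using (∃; ∃₂; _×_; _,_; proj₁; proj₂)
open import Data.Sum.Base using (inj₁; inj₂)
open import Data.Unit.Base using (tt)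
open import Data.Vec.Base using (Vec; fromList; toList)
open import Data.Vec.Membership.Propositional.Properties using (∈-toList⁺; ∈-toList⁻)
open import Data.Vec.Properties using (cast-is-id; length-toList; toList-injective; toList∘fromList)
open import Function.Base using (_∘_; case_of_; id)
open import Function.Bundles using (Equivalence; _⇔_; mk⇔)
open import Level using (0ℓ)
open import Relation.Binary.Construct.Closure.ReflexiveTransitive using (Star; ε; _◅_; _◅◅_)
open import Relation.Binary.Core using (Rel)
open import Relation.Binary.Definitions using (DecidableEquality)
open import Relation.Binary.PropositionalEquality
  using (_≡_; _≢_; refl; sym; trans; cong; cong₂; subst; subst₂; setoid; module ≡-Reasoning)
open import Relation.Nullary using (¬_; yes; no)
open import Relation.Nullary.Decidable using (_×-dec_)
open import Relation.Unary using (Pred; Decidable)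

private
  variable
    A B : Set

-- Least witnesses, cutting and joining linked lists, merging cycles.

least : ∀ {Q : Pred ℕ 0ℓ} → Decidable Q → ∀ n → Q n →
        ∃ λ k → Q k × (∀ j → j < k → ¬ Q j)
least {Q} Q? = <-rec _ λ n rec Qn → case anyUpTo? Q? n of λ where
  (yes (m , m<n , Qm)) → rec m<n Qm
  (no ∄)               → n , Qn , λ _ j<n Qj → ∄ (_ , j<n , Qj)

module _ {R : Rel A 0ℓ} where

  Linked-++⁻ˡ : ∀ xs {y zs} → Linked R (xs ++ y ∷ zs) → Linked R (xs ∷ʳ y)
  Linked-++⁻ˡ []           _          = [-]
  Linked-++⁻ˡ (x ∷ [])     (Rxy ∷ _)  = Rxy ∷ [-]
  Linked-++⁻ˡ (x ∷ y ∷ xs) (Rxy ∷ Rs) = Rxy ∷ Linked-++⁻ˡ (y ∷ xs) Rs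

  Linked-++⁻ʳ : ∀ xs {y zs} → Linked R (xs ++ y ∷ zs) → Linked R (y ∷ zs)
  Linked-++⁻ʳ []           Rs         = Rs
  Linked-++⁻ʳ (x ∷ [])     (_ ∷ Rs)   = Rs
  Linked-++⁻ʳ (x ∷ y ∷ xs) (_ ∷ Rs)   = Linked-++⁻ʳ (y ∷ xs) Rs

  Linked-join : ∀ xs {y zs} → Linked R (xs ∷ʳ y) → Linked R (y ∷ zs) → Linked R (xs ++ y ∷ zs)
  Linked-join []           _            Rs = Rs
  Linked-join (x ∷ [])     (Rxy ∷ _)    Rs = Rxy ∷ Rs
  Linked-join (x ∷ y ∷ xs) (Rxy ∷ Rxs)  Rs = Rxy ∷ Linked-join (y ∷ xs) Rxs Rs

module _ (f g : A → B) where

  private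
    Link : Rel A 0ℓ
    Link x y = f x ≡ g y

  -- The last entry enters its link only through `g`, so an entry with the same `g`-value can take
  -- its place.
  Linked-∷ʳ-resp : ∀ xs {y z} → g y ≡ g z → Linked Link (xs ∷ʳ y) → Linked Link (xs ∷ʳ z)
  Linked-∷ʳ-resp []           y≈z _         = [-]
  Linked-∷ʳ-resp (x ∷ [])     y≈z (r ∷ _)   = trans r y≈z ∷ [-]
  Linked-∷ʳ-resp (x ∷ y ∷ xs) y≈z (r ∷ rs)  = r ∷ Linked-∷ʳ-resp (y ∷ xs) y≈z rs

  -- Since `g x ≡ g y`, the entry before `x` may continue to `y` instead, and the last entry of the
  -- second cycle, which links back to `y`, may continue to `x`.
  insert-cycle : ∀ as {x bs y os} → g x ≡ g y →
                 CyclicallyLinked Link (as ++ x ∷ bs) → CyclicallyLinked Link (y ∷ os) →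
                 CyclicallyLinked Link (as ++ (y ∷ os) ++ x ∷ bs)
  insert-cycle [] {x} {bs} {y} {os} x≈y cs ds =
    -- With nothing before `x`, the merged list starts at `y`, so its closing link must end at `y`.
    subst (Linked Link ∘ (y ∷_)) (sym (++-assoc os (x ∷ bs) [ y ]))
      (Linked-join (y ∷ os) (Linked-∷ʳ-resp (y ∷ os) (sym x≈y) ds)
                            (Linked-∷ʳ-resp (x ∷ bs) x≈y cs))
  insert-cycle (a ∷ as) {x} {bs} {y} {os} x≈y cs ds =
    subst (Linked Link ∘ (a ∷_)) (sym eq)
      (Linked-join (a ∷ as) (Linked-∷ʳ-resp (a ∷ as) x≈y (Linked-++⁻ˡ (a ∷ as) cs′))
        (Linked-join (y ∷ os) (Linked-∷ʳ-resp (y ∷ os) (sym x≈y) ds)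
                              (Linked-++⁻ʳ (a ∷ as) cs′)))
    where
    cs′ : Linked Link ((a ∷ as) ++ x ∷ bs ∷ʳ a)
    cs′ = subst (Linked Link ∘ (a ∷_)) (++-assoc as (x ∷ bs) [ a ]) cs

    eq : (as ++ (y ∷ os) ++ x ∷ bs) ∷ʳ a ≡ as ++ (y ∷ os) ++ x ∷ bs ∷ʳ a
    eq = trans (++-assoc as _ [ a ]) (cong (as ++_) (++-assoc (y ∷ os) (x ∷ bs) [ a ]))

-- Eulerian circuits by splicing orbits.

-- The graph has an edge from g x to f x for every x in P.
module EulerianCircuit
  {A B : Set} (_≟_ : DecidableEquality A) (f g : A → B)
  (φ : A → A) (φ-injective : ∀ {x y} → φ x ≡ φ y → x ≡ y)
  (P : Pred A 0ℓ) (φ-closed : ∀ {x} → P x → P (φ x))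
  (φ-link : ∀ {x} → P x → f x ≡ g (φ x))
  (φ-periodic : ∀ {x} → P x → ∃ λ m → fold x φ (suc m) ≡ x)
  where

  open import Data.List.Membership.DecPropositional _≟_ using (_∈?_)

  Link : Rel A 0ℓ
  Link x y = f x ≡ g y

  -- `turn` follows the orbit of an edge; `switch` passes to another edge with the same source.
  -- Paths of such steps guide the growth of a circuit.
  data _⟶_ (x : A) : A → Set where
    turn   : x ⟶ φ x
    switch : ∀ {y} → P y → g x ≡ g y → x ⟶ y

  _⟿_ : Rel A 0ℓ
  _⟿_ = Star _⟶_

  -- `closed` keeps a circuit a union of full orbits of `φ`, so that an orbit starting outside it is
  -- disjoint from it.
  record IsCircuit (ws : List A) : Set where
    field
      unique : Unique ws
      ⊆P     : ∀ {x} → x ∈ ws → P x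
      linked : CyclicallyLinked Link ws
      closed : ∀ {x} → x ∈ ws → φ x ∈ ws

    closed* : ∀ {x} m → x ∈ ws → fold x φ m ∈ ws
    closed* zero    = id
    closed* (suc m) = closed ∘ closed* m

  open IsCircuit

  fold-P : ∀ {x} m → P x → P (fold x φ m)
  fold-P zero    = id
  fold-P (suc m) = φ-closed ∘ fold-P m

  fold-injective : ∀ {x y} m → fold x φ m ≡ fold y φ m → x ≡ y
  fold-injective zero    = id
  fold-injective (suc m) = fold-injective m ∘ φ-injective

  -- The last component, a way back to `x` from every entry, serves to prove disjointness in
  -- `splice`.
  orbit : ∀ {x} → P x → ∃ λ xs → IsCircuit (x ∷ xs) ×
                         (∀ {y} → y ∈ x ∷ xs → ∃ λ m → fold y φ m ≡ x)
  orbit {x} Px with φ-periodic Px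
  -- Taking the least return time `suc k` ensures that the listed iterates are distinct.
  ... | m , period with least {Q = λ k → fold x φ (suc k) ≡ x} (λ k → fold x φ (suc k) ≟ x) m period
  ... | k , return , first = applyUpTo (F ∘ suc) k , circuit , back
    where
    F : ℕ → A
    F = fold x φ

    distinct : ∀ {i j} → i < j → j < suc k → F i ≢ F j
    distinct {i} i<j (s≤s j≤k) eq with m≤n⇒∃[o]m+o≡n i<j
    -- Cancelling `i` applications of `φ` leaves a return to `x` after `suc d` steps, too early for
    -- `first`.
    ... | d , refl = first _ (<-≤-trans (s≤s (m≤n+m d i)) j≤k)
      (sym (fold-injective i (trans eq (trans (cong F (sym (+-suc i d))) (fold-+ x φ i)))))

    turned : ∀ {y} → y ∈ applyUpTo F (suc k) → φ y ∈ applyUpTo F (suc k)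
    turned y∈ with ∈-applyUpTo⁻ F y∈
    ... | i , s≤s i≤k , refl with m≤n⇒m<n∨m≡n i≤k
    ...   | inj₁ i<k  = ∈-applyUpTo⁺ F (s≤s i<k)
    ...   | inj₂ refl = here return

    circuit : IsCircuit (applyUpTo F (suc k))
    circuit .unique = Unique.applyUpTo⁺₁ F (suc k) distinct
    circuit .⊆P y∈ with ∈-applyUpTo⁻ F y∈
    ... | i , _ , refl = fold-P i Px
    -- The iterates up to `F (suc k)` are linked in a row, and `return` identifies the last one with
    -- `x`, which closes the cycle.
    circuit .linked = subst (Linked Link)
      (trans (sym (applyUpTo-∷ʳ F (suc k))) (cong (applyUpTo F (suc k) ∷ʳ_) return))
      (Linkedₚ.applyUpTo⁺₂ F (suc (suc k)) (λ i → φ-link (fold-P i Px)))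
    circuit .closed = turned

    back : ∀ {y} → y ∈ applyUpTo F (suc k) → ∃ λ m → fold y φ m ≡ x
    back y∈ with ∈-applyUpTo⁻ F y∈
    ... | i , i<1+k , refl = suc k ∸ i ,
      trans (sym (fold-+ x φ (suc k ∸ i))) (trans (cong F (m∸n+n≡m (<⇒≤ i<1+k))) return)

  splice : ∀ {ws x y} → IsCircuit ws → x ∈ ws → P y → g x ≡ g y → y ∉ ws →
           ∃ λ ws′ → IsCircuit ws′ × ws ⊆ ws′ × y ∈ ws′
  splice {x = x} {y} ws-circuit x∈ws Py x≈y y∉ws with ∈-∃++ x∈ws
  ... | as , bs , refl with orbit Py
  ... | os , os-circuit , back = as ++ (y ∷ os) ++ x ∷ bs , circuit , ws⊆ , y∈
    where
    moved : (y ∷ os) ++ as ++ x ∷ bs ↭ as ++ (y ∷ os) ++ x ∷ bs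
    moved = shifts (y ∷ os) as

    y∈ : y ∈ as ++ (y ∷ os) ++ x ∷ bs
    y∈ = ∈-++⁺ʳ as (here refl)

    ws⊆ : as ++ x ∷ bs ⊆ as ++ (y ∷ os) ++ x ∷ bs
    ws⊆ = ∈-resp-↭ moved ∘ ∈-++⁺ʳ (y ∷ os)

    os⊆ : y ∷ os ⊆ as ++ (y ∷ os) ++ x ∷ bs
    os⊆ = ∈-resp-↭ moved ∘ ∈-++⁺ˡ

    split : ∀ {v} {Q : Set} → v ∈ as ++ (y ∷ os) ++ x ∷ bs →
            (v ∈ y ∷ os → Q) → (v ∈ as ++ x ∷ bs → Q) → Q
    split v∈ l r with ∈-++⁻ (y ∷ os) (∈-resp-↭ (↭-sym moved) v∈)
    ... | inj₁ v∈os = l v∈os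
    ... | inj₂ v∈ws = r v∈ws

    circuit : IsCircuit (as ++ (y ∷ os) ++ x ∷ bs)
    circuit .unique = PermutationSetoid.Unique-resp-↭ (setoid A) (↭⇒↭ₛ moved)
      -- From a common entry, iterating `φ` leads to `y` without leaving the old circuit,
      -- contradicting `y∉ws`.
      (Unique.++⁺ (unique os-circuit) (unique ws-circuit) λ where
        (v∈os , v∈ws) → let m , eq = back v∈os in
          y∉ws (subst (_∈ _) eq (closed* ws-circuit m v∈ws)))
    circuit .⊆P v∈ = split v∈ (⊆P os-circuit) (⊆P ws-circuit)
    circuit .linked = insert-cycle f g as x≈y (linked ws-circuit) (linked os-circuit)
    circuit .closed v∈ = split v∈ (os⊆ ∘ closed os-circuit) (ws⊆ ∘ closed ws-circuit)

  -- Induction on the path: a `turn` stays inside the circuit, and a `switch` to a missing edge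
  -- triggers a splice.
  reach : ∀ {ws x y} → IsCircuit ws → x ∈ ws → x ⟿ y →
          ∃ λ ws′ → IsCircuit ws′ × ws ⊆ ws′ × y ∈ ws′
  reach c x∈ ε              = _ , c , id , x∈
  reach c x∈ (turn ◅ ys)    = reach c (closed c x∈) ys
  reach {ws} c x∈ (switch {y} Py x≈y ◅ ys) with y ∈? ws
  ... | yes y∈ = reach c y∈ ys
  ... | no  y∉ =
    let _ , c₁ , ws⊆ws₁  , y∈ = splice c x∈ Py x≈y y∉
        _ , c₂ , ws₁⊆ws₂ , z∈ = reach c₁ y∈ ys
    in  _ , c₂ , ws₁⊆ws₂ ∘ ws⊆ws₁ , z∈

  reach-all : ∀ {ws x} → IsCircuit ws → x ∈ ws → ∀ ys → (∀ {y} → y ∈ ys → x ⟿ y) →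
              ∃ λ ws′ → IsCircuit ws′ × ws ⊆ ws′ × ys ⊆ ws′
  reach-all c x∈ []       _    = _ , c , id , λ ()
  reach-all c x∈ (y ∷ ys) x⟿ys =
    let _ , c₁ , ws⊆ws₁  , ys⊆ = reach-all c x∈ ys (x⟿ys ∘ there)
        _ , c₂ , ws₁⊆ws₂ , y∈  = reach c₁ (ws⊆ws₁ x∈) (x⟿ys (here refl))
    in  _ , c₂ , ws₁⊆ws₂ ∘ ws⊆ws₁ , λ where
          (here refl) → y∈
          (there z∈)  → ws₁⊆ws₂ (ys⊆ z∈)

  -- The list `us` makes `P` finite and supplies the targets; the circuit starts as the orbit of its
  -- first entry and grows until it contains them all.
  eulerian : ∀ us → (∀ {x} → (x ∈ us) ⇔ P x) → (∀ {x y} → P x → P y → x ⟿ y) →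
             ∃ λ ws → Unique ws × (∀ {x} → (x ∈ ws) ⇔ P x) × CyclicallyLinked Link ws
  eulerian []       us⇔P _         = [] , AllPairs.[] , us⇔P , tt
  eulerian (u ∷ us) us⇔P connected =
    let Pu               = to us⇔P (here refl)
        _ , c₁ , _       = orbit Pu
        _ , c₂ , _ , us⊆ = reach-all c₁ (here refl) (u ∷ us) (connected Pu ∘ to us⇔P)
    in  _ , unique c₂ , mk⇔ (⊆P c₂) (us⊆ ∘ from us⇔P) , linked c₂
    where open Equivalence

-- Rotations of lists, and inverses modulo the length.

rotate : List A → List A
rotate []       = []
rotate (x ∷ xs) = xs ∷ʳ x

rotate-injective : ∀ {xs ys : List A} → rotate xs ≡ rotate ys → xs ≡ ys
rotate-injective {xs = []}     {[]}     eq = refl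
rotate-injective {xs = []}         {_ ∷ []}     ()
rotate-injective {xs = []}         {_ ∷ _ ∷ _}  ()
rotate-injective {xs = _ ∷ []}     {[]}         ()
rotate-injective {xs = _ ∷ _ ∷ _}  {[]}         ()
rotate-injective {xs = x ∷ xs} {y ∷ ys} eq with ∷ʳ-injective xs ys eq
... | refl , refl = refl

rotate-↭ : ∀ (xs : List A) → xs ↭ rotate xs
rotate-↭ []       = ↭-refl
rotate-↭ (x ∷ xs) = ∷↭∷ʳ x xs

fold-rotate-↭ : ∀ (xs : List A) k → xs ↭ fold xs rotate k
fold-rotate-↭ xs zero    = ↭-refl
fold-rotate-↭ xs (suc k) = ↭-trans (fold-rotate-↭ xs k) (rotate-↭ _)

fold-rotate-injective : ∀ {xs ys : List A} k → fold xs rotate k ≡ fold ys rotate k → xs ≡ ys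
fold-rotate-injective zero    = id
fold-rotate-injective (suc k) = fold-rotate-injective k ∘ rotate-injective

rotate-++ : ∀ (xs ys : List A) → fold (xs ++ ys) rotate (length xs) ≡ ys ++ xs
rotate-++ []       ys = sym (++-identityʳ ys)
rotate-++ (x ∷ xs) ys = begin
  -- `fold` puts the last rotation outermost; pulling the first one inside moves `x` to the end,
  -- ready for the induction.
  fold (x ∷ xs ++ ys) rotate (suc (length xs))      ≡⟨ fold-shift (length xs) ⟩
  fold ((xs ++ ys) ∷ʳ x) rotate (length xs)         ≡⟨ cong (λ zs → fold zs rotate (length xs)) (++-assoc xs ys [ x ]) ⟩
  fold (xs ++ ys ∷ʳ x) rotate (length xs)           ≡⟨ rotate-++ xs (ys ∷ʳ x) ⟩
  ys ∷ʳ x ++ xs                                     ≡⟨ ∷ʳ-++ ys x xs ⟩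
  ys ++ x ∷ xs                                      ∎
  where
  open ≡-Reasoning
  fold-shift : ∀ {zs} k → fold zs rotate (suc k) ≡ fold (rotate zs) rotate k
  fold-shift zero    = refl
  fold-shift (suc k) = cong rotate (fold-shift k)

rotate-by : ∀ k (xs : List A) → k ≤ length xs → fold xs rotate k ≡ drop k xs ++ take k xs
rotate-by k xs k≤ = begin
  fold xs rotate k                                          ≡⟨ cong₂ (λ zs → fold zs rotate) (take++drop≡id k xs) length-prefix ⟨
  fold (take k xs ++ drop k xs) rotate (length (take k xs)) ≡⟨ rotate-++ (take k xs) (drop k xs) ⟩
  drop k xs ++ take k xs                                    ∎
  where
  open ≡-Reasoning
  length-prefix : length (take k xs) ≡ k
  length-prefix = trans (length-take k xs) (m≤n⇒m⊓n≡m k≤)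

rotate-length : ∀ k (xs : List A) → fold xs rotate (k * length xs) ≡ xs
rotate-length zero    xs = refl
rotate-length (suc k) xs = begin
  fold xs rotate (length xs + k * length xs)              ≡⟨ fold-+ xs rotate (length xs) ⟩
  fold (fold xs rotate (k * length xs)) rotate (length xs) ≡⟨ cong (λ zs → fold zs rotate (length xs)) (rotate-length k xs) ⟩
  fold xs rotate (length xs)                              ≡⟨ cong (λ zs → fold zs rotate (length xs)) (++-identityʳ xs) ⟨
  fold (xs ++ []) rotate (length xs)                      ≡⟨ rotate-++ xs [] ⟩
  xs                                                      ∎
  where open ≡-Reasoning

fold-rotate-* : ∀ (xs : List A) k m →
                fold xs (λ ys → fold ys rotate k) m ≡ fold xs rotate (m * k)
fold-rotate-* xs k zero    = refl
fold-rotate-* xs k (suc m) = trans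
  (cong (λ ys → fold ys rotate k) (fold-rotate-* xs k m)) (sym (fold-+ xs rotate k))

take-++-≤ : ∀ k (xs ys : List A) → k ≤ length xs → take k (xs ++ ys) ≡ take k xs
take-++-≤ zero    xs       ys _        = refl
take-++-≤ (suc k) (x ∷ xs) ys (s≤s k≤) = cong (x ∷_) (take-++-≤ k xs ys k≤)

-- When Bézout's identity inverts -t instead of t, multiply by n - 1 = n′ to
-- change the sign, and add n copies of t = 1 + t′ to avoid subtraction.
coprime⇒inverse : ∀ {t′ n′} → Coprime (suc t′) (suc n′) →
                  ∃₂ λ m k → m * suc t′ ≡ 1 + k * suc n′
coprime⇒inverse {t′} {n′} coprime with coprime-Bézout coprime
... | Bézout.+- x y eq = x , y , sym eq
... | Bézout.-+ x y eq = x * n′ + suc n′ , y * n′ + t′ , (begin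
  (x * n′ + suc n′) * suc t′          ≡⟨ rearrange x n′ t′ ⟩
  1 + n′ * (1 + x * suc t′) + t′ * suc n′ ≡⟨ cong (λ z → 1 + n′ * z + t′ * suc n′) eq ⟩
  1 + n′ * (y * suc n′) + t′ * suc n′ ≡⟨ collect y n′ t′ ⟩
  1 + (y * n′ + t′) * suc n′          ∎)
  where
  open ≡-Reasoning
  rearrange : ∀ x n t → (x * n + suc n) * suc t ≡ 1 + n * (1 + x * suc t) + t * suc n
  rearrange = solve-∀
  collect : ∀ y n t → 1 + n * (y * suc n) + t * suc n ≡ 1 + (y * n + t) * suc n
  collect = solve-∀

-- Extracting distinct letters, and enumerating words.

⊆⇒↭++ : ∀ {us xs : List A} → Unique us → us ⊆ xs → ∃ λ rs → xs ↭ rs ++ us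
⊆⇒↭++ {us = []}     {xs} _          _  = xs , ↭-reflexive (sym (++-identityʳ xs))
⊆⇒↭++ {us = u ∷ us} (u∉ AllPairs.∷ us-unique) us⊆ with ∈-∃++ (us⊆ (here refl))
... | as , bs , refl =
  -- The other letters of `us` differ from `u`, so they survive its removal.
  let rs , eq = ⊆⇒↭++ us-unique λ v∈us →
        Any.tail (All.lookup u∉ v∈us ∘ sym) (∈-resp-↭ (shift u as bs) (us⊆ (there v∈us)))
  in  rs , ↭-trans (shift u as bs) (↭-trans (↭-prep u eq) (↭-sym (shift u rs us)))

tuples : List A → ℕ → List (List A)
tuples us zero    = [ [] ]
tuples us (suc n) = cartesianProductWith _∷_ us (tuples us n)

∈-tuples : ∀ {us} (xs : List A) → xs ⊆ us → xs ∈ tuples us (length xs)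
∈-tuples []       _   = here refl
∈-tuples (x ∷ xs) xs⊆ = ∈-cartesianProductWith⁺ _∷_ (xs⊆ (here refl)) (∈-tuples xs (xs⊆ ∘ there))

-- Connecting all words with a prescribed set of letters.

module Words {A : Set} (_≟_ : DecidableEquality A) {us : List A} (us-unique : Unique us)
             (t s : ℕ) (coprime : Coprime (2 + t) (2 + t + s)) where

  open import Data.List.Relation.Binary.Subset.DecPropositional _≟_ using (_⊆?_)

  -- Writing n - s as `2 + t` builds in the bound n - s ≥ 2.
  n : ℕ
  n = 2 + t + s

  P : Pred (List A) 0ℓ
  P xs = length xs ≡ n × xs ⊆ us × us ⊆ xs

  P? : Decidable P
  P? xs = (length xs ≟ℕ n) ×-dec (xs ⊆? us) ×-dec (us ⊆? xs)

  P-resp-↭ : ∀ {xs ys} → xs ↭ ys → P xs → P ys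
  P-resp-↭ xs↭ys (len , xs⊆ , ⊆xs) =
    trans (sym (↭-length xs↭ys)) len , xs⊆ ∘ ∈-resp-↭ (↭-sym xs↭ys) , ∈-resp-↭ xs↭ys ∘ ⊆xs

  shiftBy : List A → List A
  shiftBy xs = fold xs rotate (2 + t)

  shiftBy-link : ∀ {xs} → P xs → drop (2 + t) xs ≡ take s (shiftBy xs)
  shiftBy-link {xs} (len , _) = sym (begin
    take s (shiftBy xs)                        ≡⟨ cong (take s) (rotate-by (2 + t) xs (subst (2 + t ≤_) (sym len) (m≤m+n _ s))) ⟩
    take s (drop (2 + t) xs ++ take (2 + t) xs) ≡⟨ take-++-≤ s _ _ (≤-reflexive (sym length-suffix)) ⟩
    take s (drop (2 + t) xs)                   ≡⟨ take-all s _ (≤-reflexive length-suffix) ⟩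
    drop (2 + t) xs                            ∎)
    where
    open ≡-Reasoning
    length-suffix : length (drop (2 + t) xs) ≡ s
    length-suffix = trans (length-drop (2 + t) xs) (trans (cong (_∸ (2 + t)) len) (m+n∸m≡n (2 + t) s))

  shiftBy-periodic : ∀ {xs} → P xs → ∃ λ m → fold xs shiftBy (suc m) ≡ xs
  -- `suc (t + s)` is n - 1, so the shift is applied n times, which amounts to `2 + t` full turns.
  shiftBy-periodic {xs} (len , _) = suc (t + s) , (begin
    fold xs shiftBy n                     ≡⟨ fold-rotate-* xs (2 + t) n ⟩
    fold xs rotate (n * (2 + t))          ≡⟨ cong (fold xs rotate) (*-comm n (2 + t)) ⟩
    fold xs rotate ((2 + t) * n)          ≡⟨ cong (λ k → fold xs rotate ((2 + t) * k)) len ⟨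
    fold xs rotate ((2 + t) * length xs)  ≡⟨ rotate-length (2 + t) xs ⟩
    xs                                    ∎)
    where open ≡-Reasoning

  open EulerianCircuit (≡-dec _≟_) (drop (2 + t)) (take s)
    shiftBy (fold-rotate-injective (2 + t)) P (λ {xs} → P-resp-↭ (fold-rotate-↭ xs (2 + t)))
    shiftBy-link shiftBy-periodic

  turns : ∀ {xs} m → xs ⟿ fold xs shiftBy m
  turns zero    = ε
  turns (suc m) = turns m ◅◅ turn ◅ ε

  -- With m (n - s) = 1 + k n, applying the shift m times makes k full turns and one single
  -- rotation.
  rotate-⟿ : ∀ {xs} → P xs → xs ⟿ rotate xs
  rotate-⟿ {xs} (len , _) with coprime⇒inverse coprime
  ... | m , k , inverse = subst (xs ⟿_) eq (turns m)
    where
    open ≡-Reasoning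
    eq : fold xs shiftBy m ≡ rotate xs
    eq = begin
      fold xs shiftBy m                       ≡⟨ fold-rotate-* xs (2 + t) m ⟩
      fold xs rotate (m * (2 + t))            ≡⟨ cong (fold xs rotate) inverse ⟩
      rotate (fold xs rotate (k * n))         ≡⟨ cong (λ l → rotate (fold xs rotate (k * l))) len ⟨
      rotate (fold xs rotate (k * length xs)) ≡⟨ cong rotate (rotate-length k xs) ⟩
      rotate xs                               ∎

  rotations-⟿ : ∀ {xs} → P xs → ∀ k → xs ⟿ fold xs rotate k
  rotations-⟿ Pxs zero    = ε
  rotations-⟿ Pxs (suc k) =
    rotations-⟿ Pxs k ◅◅ rotate-⟿ (P-resp-↭ (fold-rotate-↭ _ k) Pxs)

  ++-comm-⟿ : ∀ xs ys → P (xs ++ ys) → (xs ++ ys) ⟿ (ys ++ xs)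
  ++-comm-⟿ xs ys Pxs = subst ((xs ++ ys) ⟿_) (rotate-++ xs ys) (rotations-⟿ Pxs (length xs))

  -- Rotated to the end, the first two letters lie beyond the prefix of length s.
  change-⟿ : ∀ {a b c d} xs → P (a ∷ b ∷ xs) → P (c ∷ d ∷ xs) → (a ∷ b ∷ xs) ⟿ (c ∷ d ∷ xs)
  change-⟿ {a} {b} {c} {d} xs P₁ P₂ =
    ++-comm-⟿ (a ∷ b ∷ []) xs P₁ ◅◅ switch P₃ same-prefix ◅ ++-comm-⟿ xs (c ∷ d ∷ []) P₃
    where
    P₃ : P (xs ++ c ∷ d ∷ [])
    P₃ = P-resp-↭ (++-comm (c ∷ d ∷ []) xs) P₂

    s≤xs : s ≤ length xs
    s≤xs = subst (s ≤_) (sym (suc-injective (suc-injective (proj₁ P₁)))) (m≤n+m s t)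

    same-prefix : take s (xs ++ a ∷ b ∷ []) ≡ take s (xs ++ c ∷ d ∷ [])
    same-prefix = trans (take-++-≤ s xs _ s≤xs) (sym (take-++-≤ s xs _ s≤xs))

  -- Paths exist only between words of full length, so `ps` carries along the letters that the
  -- permutation has already passed.
  ↭⇒⟿ : ∀ {xs ys} → xs ↭ ys → ∀ ps → P (ps ++ xs) → (ps ++ xs) ⟿ (ps ++ ys)
  ↭⇒⟿ _↭_.refl ps Pxs = ε
  ↭⇒⟿ (prep {xs} {ys} x xs↭ys) ps Pxs =
    subst₂ _⟿_ (∷ʳ-++ ps x xs) (∷ʳ-++ ps x ys)
      (↭⇒⟿ xs↭ys (ps ∷ʳ x) (subst P (sym (∷ʳ-++ ps x xs)) Pxs))
  ↭⇒⟿ (swap {xs} {ys} x y xs↭ys) ps Pxs =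
    -- The pair is rotated to the front, exchanged there, and rotated back.
    ++-comm-⟿ ps (x ∷ y ∷ xs) Pxs ◅◅
    change-⟿ (xs ++ ps) P₁ P₂ ◅◅
    ++-comm-⟿ (y ∷ x ∷ xs) ps P₂ ◅◅
    subst₂ _⟿_ (++-assoc ps _ xs) (++-assoc ps _ ys)
      (↭⇒⟿ xs↭ys (ps ++ y ∷ x ∷ []) (subst P (sym (++-assoc ps _ xs)) (P-resp-↭ (++-comm (y ∷ x ∷ xs) ps) P₂)))
    where
    P₁ : P (x ∷ y ∷ xs ++ ps)
    P₁ = P-resp-↭ (++-comm ps (x ∷ y ∷ xs)) Pxs
    P₂ : P (y ∷ x ∷ xs ++ ps)
    P₂ = P-resp-↭ (↭-swap x y ↭-refl) P₁
  ↭⇒⟿ (_↭_.trans xs↭ys ys↭zs) ps Pxs =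
    ↭⇒⟿ xs↭ys ps Pxs ◅◅ ↭⇒⟿ ys↭zs ps (P-resp-↭ (++⁺ˡ ps xs↭ys) Pxs)

  -- The first two letters are changed together, the second one to itself.
  change-head-⟿ : ∀ {c d} xs → P (c ∷ xs) → P (d ∷ xs) → (c ∷ xs) ⟿ (d ∷ xs)
  change-head-⟿ []       (() , _)
  change-head-⟿ (x ∷ xs) = change-⟿ xs

  -- The copy of `us` at the end keeps every required letter present, so all intermediate words
  -- satisfy `P`.
  replace-⟿ : ∀ ps rs rs′ → length rs ≡ length rs′ → rs′ ⊆ us → P (ps ++ rs ++ us) →
              (ps ++ rs ++ us) ⟿ (ps ++ rs′ ++ us)
  replace-⟿ ps []       []        _   _    _  = ε
  replace-⟿ ps (c ∷ rs) (d ∷ rs′) len rs′⊆ P₀ =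
    ↭⇒⟿ (shift c ps (rs ++ us)) [] P₀ ◅◅
    change-head-⟿ (ps ++ rs ++ us) P₁ P₂ ◅◅
    ↭⇒⟿ (↭-sym (shift d ps (rs ++ us))) [] P₂ ◅◅
    subst₂ _⟿_ (∷ʳ-++ ps d (rs ++ us)) (∷ʳ-++ ps d (rs′ ++ us))
      (replace-⟿ (ps ∷ʳ d) rs rs′ (suc-injective len) (rs′⊆ ∘ there)
        (subst P (sym (∷ʳ-++ ps d (rs ++ us))) (P-resp-↭ (↭-sym (shift d ps (rs ++ us))) P₂)))
    where
    P₁ : P (c ∷ ps ++ rs ++ us)
    P₁ = P-resp-↭ (shift c ps (rs ++ us)) P₀
    P₂ : P (d ∷ ps ++ rs ++ us)
    P₂ = proj₁ P₁
       , (λ { (here refl) → rs′⊆ (here refl) ; (there v∈) → proj₁ (proj₂ P₁) (there v∈) })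
       , there ∘ ∈-++⁺ʳ ps ∘ ∈-++⁺ʳ rs

  -- Setting aside one copy of each letter of `us` leaves `rs` and `rs′`, which are equally long
  -- because both words have length `n`.
  connected : ∀ {xs ys} → P xs → P ys → xs ⟿ ys
  connected {xs} {ys} Pxs Pys
    with ⊆⇒↭++ us-unique (proj₂ (proj₂ Pxs)) | ⊆⇒↭++ us-unique (proj₂ (proj₂ Pys))
  ... | rs , xs↭ | rs′ , ys↭ =
    ↭⇒⟿ xs↭ [] Pxs ◅◅
    replace-⟿ [] rs rs′ same-length (proj₁ (proj₂ P₂) ∘ ∈-++⁺ˡ) P₁ ◅◅
    ↭⇒⟿ (↭-sym ys↭) [] P₂
    where
    P₁ : P (rs ++ us)
    P₁ = P-resp-↭ xs↭ Pxs
    P₂ : P (rs′ ++ us)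
    P₂ = P-resp-↭ ys↭ Pys
    same-length : length rs ≡ length rs′
    same-length = +-cancelʳ-≡ (length us) _ _ (trans (sym (length-++ rs))
      (trans (proj₁ P₁) (trans (sym (proj₁ P₂)) (length-++ rs′))))

  ocycle : ∃ λ ws → Unique ws × (∀ {x} → (x ∈ ws) ⇔ P x) × CyclicallyLinked Link ws
  ocycle = eulerian (filter P? (tuples us n))
    (mk⇔ (proj₂ ∘ ∈-filter⁻ P? {xs = tuples us n})
         λ Pxs@(len , xs⊆ , _) →
           ∈-filter⁺ P? (subst ((_ ∈_) ∘ tuples us) len (∈-tuples _ xs⊆)) Pxs)
    connected

-- From lists to vectors, and the theorem.

toVecs : ∀ {n} (xss : List (List A)) → (∀ {xs} → xs ∈ xss → length xs ≡ n) →
         ∃ λ (vs : List (Vec A n)) → map toList vs ≡ xss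
toVecs []         _   = [] , refl
toVecs (xs ∷ xss) len with len (here refl) | toVecs xss (len ∘ there)
... | refl | vs , refl = fromList xs ∷ vs , cong (_∷ map toList vs) (toList∘fromList xs)

toList-injective′ : ∀ {n} {v w : Vec A n} → toList v ≡ toList w → v ≡ w
toList-injective′ {v = v} {w} eq = trans (sym (cast-is-id refl v)) (toList-injective refl v w eq)

theorem4p5 : ∀ (n s h : ℕ) → 1 ≤ s → s + 2 ≤ n → gcd s n ≡ 1 → h < n →
    ∃ λ ws → IsOcycle s (𝒲 n h) ws
theorem4p5 n s h _ s+2≤n gcd≡1 _ with m≤n⇒∃[o]m+o≡n s+2≤n
-- Here `t` is n - s - 2; matching on the equation replaces `n` by `2 + t + s`.
... | t , eq with trans (sym eq) (trans (+-assoc s 2 t) (+-comm s (2 + t)))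
...   | refl = ocycle-of-words
  where
  open Equivalence

  coprime : Coprime (2 + t) (2 + t + s)
  -- A common divisor of n - s and n also divides their difference s.
  coprime (d∣t , d∣n) = gcd≡1⇒coprime gcd≡1 (∣m+n∣m⇒∣n d∣n d∣t , d∣n)

  -- `upTo` excludes its bound, so `suc h` yields the letters 0, ..., h.
  open Words _≟ℕ_ (Unique.upTo⁺ (suc h)) t s coprime using (P; ocycle)

  𝒲⇒P : ∀ {w} → 𝒲 n h w → P (toList w)
  𝒲⇒P {w} w∈𝒲 = length-toList w
               , (λ k∈w → ∈-upTo⁺ (s≤s (to (w∈𝒲 _) (∈-toList⁻ k∈w))))
               , (λ k∈U → ∈-toList⁺ (from (w∈𝒲 _) (≤-pred (∈-upTo⁻ k∈U))))

  P⇒𝒲 : ∀ {w} → P (toList w) → 𝒲 n h w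
  P⇒𝒲 (_ , w⊆U , U⊆w) k = mk⇔
    (λ k∈w → ≤-pred (∈-upTo⁻ (w⊆U (∈-toList⁺ k∈w))))
    (λ k≤h → ∈-toList⁻ (U⊆w (∈-upTo⁺ (s≤s k≤h))))

  drop-take⇒Overlap : ∀ {v w : Word n} → drop (2 + t) (toList v) ≡ take s (toList w) → Overlap s v w
  drop-take⇒Overlap {v} = trans (cong (λ k → drop k (toList v)) (m+n∸n≡m (2 + t) s))

  ocycle-of-words : ∃ λ ws → IsOcycle s (𝒲 n h) ws
  ocycle-of-words with ocycle
  ... | xss , xss-unique , xss⇔P , xss-linked with toVecs xss (proj₁ ∘ to xss⇔P)
  ... | ws , refl = ws , record
    { unique   = Unique.map⁻ xss-unique
    ; lists    = λ w → mk⇔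
        (P⇒𝒲 ∘ to xss⇔P ∘ ∈-map⁺ toList)
        (λ w∈𝒲 → let v , v∈ws , eq = ∈-map⁻ toList (from xss⇔P (𝒲⇒P w∈𝒲))
                 in  subst (_∈ ws) (sym (toList-injective′ eq)) v∈ws)
    ; overlaps = linked ws xss-linked
    }
    where
    linked : ∀ vs → CyclicallyLinked (λ xs ys → drop (2 + t) xs ≡ take s ys) (map toList vs) →
             CyclicallyLinked (Overlap s) vs
    linked []       _  = tt
    linked (v ∷ vs) rs = Linked.map drop-take⇒Overlap (Linkedₚ.map⁻
      (subst (Linked _) (sym (cong (toList v ∷_) (map-++ toList vs [ v ]))) rs))
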